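{- Let $A$ be an $n \times n$ real symmetric matrix and let $\alpha \subseteq \{1,2,\dots,n\}$ with $|\alpha| \geq 2$. Then $\alpha$ is a P-set of $A$ if and only if every subset $\gamma \subseteq \alpha$ with $|\gamma| = 2$ is a P-set of $A$.
   Context: All matrices are real. For an $n\times n$ matrix $A$ and $\alpha \subseteq \{1,\dots,n\}$, $A(\alpha)$ denotes the principal submatrix obtained by deleting the rows and columns indexed by $\alpha$, and $\nu(A)$ denotes the nullity of $A$. A set $\alpha$ is a P-set of $A$ if $\nu(A(\alpha)) = \nu(A) + |\alpha|$. -}

module Defs where

open import Algebra.Bundles using (CommutativeRing)
open import Algebra.Core using (Op₁; Op₂)
open import Algebra.Structures using (IsCommutativeRing)
import Algebra.Properties.Semiring.Sum as Sum
open import Data.Fin.Base using (Fin; zero; suc)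
open import Data.Fin.Subset using (Subset; inside; outside; ∣_∣; ∁)
open import Data.Nat.Base as ℕ using (ℕ)
open import Data.Product.Base using (Σ; ∃; _×_)
open import Data.Vec.Base using ([]; _∷_)
open import Data.Vec.Functional using (Vector)
open import Level using (Level; _⊔_) renaming (suc to lsuc)
open import Relation.Binary.Core using (Rel)
open import Relation.Binary.Structures using (IsDecTotalOrder)
open import Relation.Nullary.Negation using (¬_)
open import Relation.Unary using (Pred; Satisfiable)

-- The real numbers, given by their axioms: a Dedekind-complete ordered field.
-- The order is the classical one (total, with decidable equality), so a model
-- is the classical real line; equality is the setoid equality _≈_.

record Reals c ℓ₁ ℓ₂ : Set (lsuc (c ⊔ ℓ₁ ⊔ ℓ₂)) where
  infix  8 -_
  infixl 7 _*_
  infixl 6 _+_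
  infix  4 _≈_ _≤_
  field
    Carrier           : Set c
    _≈_               : Rel Carrier ℓ₁
    _≤_               : Rel Carrier ℓ₂
    _+_               : Op₂ Carrier
    _*_               : Op₂ Carrier
    -_                : Op₁ Carrier
    0#                : Carrier
    1#                : Carrier
    isCommutativeRing : IsCommutativeRing _≈_ _+_ _*_ -_ 0# 1#
    0≉1               : ¬ 0# ≈ 1#
    inverse           : ∀ x → ¬ x ≈ 0# → ∃ λ y → x * y ≈ 1#
    isDecTotalOrder   : IsDecTotalOrder _≈_ _≤_
    +-monoˡ-≤         : ∀ z {x y} → x ≤ y → x + z ≤ y + z
    *-nonneg          : ∀ {x y} → 0# ≤ x → 0# ≤ y → 0# ≤ x * y

  UpperBound : ∀ {ℓ} → Pred Carrier ℓ → Pred Carrier (c ⊔ ℓ ⊔ ℓ₂)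
  UpperBound S b = ∀ x → S x → x ≤ b

  field
    supremum : (S : Pred Carrier (c ⊔ ℓ₁ ⊔ ℓ₂)) →
               Satisfiable S → Satisfiable (UpperBound S) →
               ∃ λ s → UpperBound S s × (∀ b → UpperBound S b → s ≤ b)

  commutativeRing : CommutativeRing c ℓ₁
  commutativeRing = record { isCommutativeRing = isCommutativeRing }

-- The increasing enumeration of the elements of a subset.

enumerate : ∀ {n} (p : Subset n) → Fin ∣ p ∣ → Fin n
enumerate (inside  ∷ p) zero    = zero
enumerate (inside  ∷ p) (suc i) = suc (enumerate p i)
enumerate (outside ∷ p) i       = suc (enumerate p i)

module _ {c ℓ₁ ℓ₂ : Level} (ℝ : Reals c ℓ₁ ℓ₂) where
  open Reals ℝ using (Carrier; _≈_; _*_; 0#; commutativeRing)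
  open Sum (CommutativeRing.semiring commutativeRing) using (sum-syntax)

  SquareMatrix : ℕ → Set c
  SquareMatrix n = Fin n → Fin n → Carrier

  Symmetric : ∀ {n} → SquareMatrix n → Set ℓ₁
  Symmetric A = ∀ i j → A i j ≈ A j i

  -- A(α): the rows and columns indexed by α are deleted, not kept.
  delete : ∀ {n} → SquareMatrix n → (α : Subset n) → SquareMatrix ∣ ∁ α ∣
  delete A α i j = A (enumerate (∁ α) i) (enumerate (∁ α) j)

  Kernel : ∀ {n} → SquareMatrix n → Pred (Vector Carrier n) ℓ₁
  Kernel {n} A x = ∀ i → ∑[ j < n ] (A i j * x j) ≈ 0#

  LinearlyIndependent : ∀ {n k} → Vector (Vector Carrier n) k → Set (c ⊔ ℓ₁)
  LinearlyIndependent {k = k} b =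
    ∀ (a : Vector Carrier k) → (∀ i → ∑[ j < k ] (a j * b j i) ≈ 0#) → ∀ j → a j ≈ 0#

  InSpan : ∀ {n k} → Vector (Vector Carrier n) k → Pred (Vector Carrier n) (c ⊔ ℓ₁)
  InSpan {k = k} b x = Σ (Vector Carrier k) λ a → ∀ i → ∑[ j < k ] (a j * b j i) ≈ x i

  record IsBasis {n k ℓ} (U : Pred (Vector Carrier n) ℓ)
                 (b : Vector (Vector Carrier n) k) : Set (c ⊔ ℓ₁ ⊔ ℓ) where
    field
      contained   : ∀ j → U (b j)
      independent : LinearlyIndependent b
      spanning    : ∀ x → U x → InSpan b x

  -- ν(A) = k, the dimension of the kernel.  As a relation, because "the"
  -- dimension is a number only after invariance of dimension is proved.
  HasNullity : ∀ {n} → SquareMatrix n → ℕ → Set (c ⊔ ℓ₁)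
  HasNullity {n} A k = Σ (Vector (Vector Carrier n) k) (IsBasis (Kernel A))

  IsPSet : ∀ {n} → SquareMatrix n → Subset n → Set (c ⊔ ℓ₁)
  IsPSet A α = ∃ λ k → HasNullity A k × HasNullity (delete A α) (k ℕ.+ ∣ α ∣)

{-# OPTIONS --safe #-}

-- A set α is a P-set of A exactly when every e_i with i ∈ α has a preimage
-- under A that vanishes on α: ker A(α) is the space of x vanishing on α with
-- A x vanishing off α, and x ↦ (A x)|α maps it to ℝ^α with kernel inside ker A,
-- so ν(A(α)) = ν(A) + |α| forces surjectivity; conversely, by symmetry such
-- preimages force ker A to vanish on α, and together with a basis of ker A they
-- form a basis of ker A(α).  This criterion is inherited by subsets.  It is also
-- determined by pairs: two preimages of e_i differ by an element of ker A,
-- which vanishes on α, so whether a preimage vanishes at j ∈ α can be tested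
-- on the one provided by the pair {i, j}.

module Submission where

open import Defs
open import Algebra.Bundles using (CommutativeRing)
import Algebra.Properties.Ring as RingProperties
import Algebra.Properties.Semiring.Sum as Sum
open import Data.Fin.Base using (Fin; zero; suc; punchIn; punchOut; _↑ˡ_; _↑ʳ_; splitAt; fromℕ<)
open import Data.Fin.Properties as Fin
  using (any?; suc-injective; punchIn-punchOut; splitAt⁻¹-↑ˡ; splitAt⁻¹-↑ʳ)
open import Data.Fin.Subset using (Subset; _⊆_; ∣_∣; _∈_; _∉_; ∁; inside; outside; ⁅_⁆; _∪_)
open import Data.Fin.Subset.Properties
  using (_∈?_; x∉p⇒x∈∁p; x∈p⇒x∉∁p; x∈∁p⇒x∉p; x∉∁p⇒x∈p; x∈⁅x⁆; x∈⁅y⁆⇒x≡y; x∈p∪q⁻; x∈p∪q⁺; ∣⁅x⁆∣≡1;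
         ∪-identityˡ; ∪-identityʳ)
open import Data.Nat.Base as ℕ using (ℕ; zero; suc; _≤_; s≤s)
import Data.Nat.Properties as ℕ
open import Data.Product.Base using (Σ; ∃; ∃₂; _×_; _,_; proj₁; proj₂)
open import Data.Sum.Base using (_⊎_; inj₁; inj₂; [_,_]′)
open import Data.Vec.Base as Vec using (here; there)
open import Data.Vec.Functional using (Vector; insertAt; updateAt; replicate; removeAt; _++_)
open import Data.Vec.Functional.Properties
  using (insertAt-lookup; insertAt-punchIn; updateAt-updates; updateAt-minimal; lookup-++ˡ; lookup-++ʳ)
open import Function.Base using (_∘_; const)
open import Function.Bundles using (_⇔_; mk⇔)
open import Level using (_⊔_)
open import Relation.Binary.PropositionalEquality.Core as ≡ using (_≡_; _≢_)
import Relation.Binary.Reasoning.Setoid as SetoidReasoning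
open import Relation.Binary.Structures using (IsDecTotalOrder)
open import Relation.Nullary.Decidable using (yes; no; ¬?; decidable-stable)
open import Relation.Nullary.Negation using (¬_; contradiction)

-- Enumerations of subsets, and two-element subsets.

enumerate-∈ : ∀ {n} (p : Subset n) i → enumerate p i ∈ p
enumerate-∈ (inside  Vec.∷ p) zero    = here
enumerate-∈ (inside  Vec.∷ p) (suc i) = there (enumerate-∈ p i)
enumerate-∈ (outside Vec.∷ p) i       = there (enumerate-∈ p i)

enumerate-surjective : ∀ {n} (p : Subset n) {j} → j ∈ p → ∃ λ i → enumerate p i ≡ j
enumerate-surjective (inside  Vec.∷ p) here        = zero , ≡.refl
enumerate-surjective (inside  Vec.∷ p) (there j∈p) =
  let i , eq = enumerate-surjective p j∈p in suc i , ≡.cong suc eq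
enumerate-surjective (outside Vec.∷ p) (there j∈p) =
  let i , eq = enumerate-surjective p j∈p in i , ≡.cong suc eq

enumerate-injective : ∀ {n} (p : Subset n) {i j} → enumerate p i ≡ enumerate p j → i ≡ j
enumerate-injective (inside  Vec.∷ p) {zero}  {zero}  eq = ≡.refl
enumerate-injective (inside  Vec.∷ p) {suc i} {suc j} eq =
  ≡.cong suc (enumerate-injective p (suc-injective eq))
enumerate-injective (outside Vec.∷ p) eq = enumerate-injective p (suc-injective eq)

∣⁅x⁆∪⁅y⁆∣≡2 : ∀ {n} {x y : Fin n} → x ≢ y → ∣ ⁅ x ⁆ ∪ ⁅ y ⁆ ∣ ≡ 2
∣⁅x⁆∪⁅y⁆∣≡2 {x = zero}  {zero}  x≢y = contradiction ≡.refl x≢y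
∣⁅x⁆∪⁅y⁆∣≡2 {x = zero}  {suc y} x≢y =
  ≡.cong suc (≡.trans (≡.cong ∣_∣ (∪-identityˡ ⁅ y ⁆)) (∣⁅x⁆∣≡1 y))
∣⁅x⁆∪⁅y⁆∣≡2 {x = suc x} {zero}  x≢y =
  ≡.cong suc (≡.trans (≡.cong ∣_∣ (∪-identityʳ ⁅ x ⁆)) (∣⁅x⁆∣≡1 x))
∣⁅x⁆∪⁅y⁆∣≡2 {x = suc x} {suc y} x≢y = ∣⁅x⁆∪⁅y⁆∣≡2 (x≢y ∘ ≡.cong suc)

pair⊆ : ∀ {n} {p : Subset n} {x y} → x ∈ p → y ∈ p → ⁅ x ⁆ ∪ ⁅ y ⁆ ⊆ p
pair⊆ {p = p} {x} {y} x∈p y∈p z∈ =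
  [ (λ z∈x → ≡.subst (_∈ p) (≡.sym (x∈⁅y⁆⇒x≡y x z∈x)) x∈p)
  , (λ z∈y → ≡.subst (_∈ p) (≡.sym (x∈⁅y⁆⇒x≡y y z∈y)) y∈p) ]′ (x∈p∪q⁻ ⁅ x ⁆ ⁅ y ⁆ z∈)

another : ∀ {m} → 2 ≤ m → (i : Fin m) → ∃ λ j → i ≢ j
another (s≤s (s≤s _)) zero    = suc zero , λ ()
another (s≤s (s≤s _)) (suc i) = zero , λ ()

another-∈ : ∀ {n} (p : Subset n) → 2 ≤ ∣ p ∣ → ∀ {i} → i ∈ p → ∃ λ j → j ∈ p × i ≢ j
another-∈ p 2≤∣p∣ i∈p with i′ , ≡.refl ← enumerate-surjective p i∈p =
  let j′ , i′≢j′ = another 2≤∣p∣ i′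
  in enumerate p j′ , enumerate-∈ p j′ , i′≢j′ ∘ enumerate-injective p

module _ {c ℓ₁ ℓ₂} (ℝ : Reals c ℓ₁ ℓ₂) where
  open Reals ℝ using (commutativeRing; inverse; 0≉1; isDecTotalOrder)
  open CommutativeRing commutativeRing hiding (zero)
  open RingProperties ring using (-‿distribˡ-*; -‿distribʳ-*; -0#≈0#; x∙y⁻¹≈ε⇒x≈y; xyx⁻¹≈y; //-rightDividesˡ)
  open Sum semiring
  open IsDecTotalOrder isDecTotalOrder using (_≟_)
  open SetoidReasoning setoid

  -- Finite sums.

  sum-cong : ∀ {n} {f g : Vector Carrier n} → (∀ i → f i ≈ g i) → sum f ≈ sum g
  sum-cong = sum-cong-≋

  sum-zero : ∀ {n} {f : Vector Carrier n} → (∀ i → f i ≈ 0#) → sum f ≈ 0#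
  sum-zero {n} f≈0 = trans (sum-cong f≈0) (sum-replicate-zero n)

  sum-single : ∀ {n} i {f : Vector Carrier n} → (∀ j → j ≢ i → f j ≈ 0#) → sum f ≈ f i
  sum-single {suc n} i {f} f≈0 = begin
    sum f                       ≈⟨ sum-remove f ⟩
    f i + sum (removeAt f i)    ≈⟨ +-congˡ (sum-zero λ j → f≈0 _ (Fin.punchInᵢ≢i i j)) ⟩
    f i + 0#                    ≈⟨ +-identityʳ _ ⟩
    f i                         ∎

  sum-↑ : ∀ m {n} (f : Vector Carrier (m ℕ.+ n)) →
          sum f ≈ sum (f ∘ (_↑ˡ n)) + sum (f ∘ (m ↑ʳ_))
  sum-↑ zero    f = sym (+-identityˡ _)
  sum-↑ (suc m) f = trans (+-congˡ (sum-↑ m (f ∘ suc))) (sym (+-assoc _ _ _))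

  sum-enumerate : ∀ {n} (p : Subset n) {f : Vector Carrier n} →
                  (∀ j → j ∉ p → f j ≈ 0#) → sum f ≈ sum (f ∘ enumerate p)
  sum-enumerate Vec.[] f≈0 = refl
  sum-enumerate (inside Vec.∷ p) f≈0 =
    +-congˡ (sum-enumerate p λ j j∉p → f≈0 (suc j) λ { (there j∈p) → j∉p j∈p })
  sum-enumerate (outside Vec.∷ p) f≈0 =
    trans (+-cong (f≈0 zero λ ())
                  (sum-enumerate p λ j j∉p → f≈0 (suc j) λ { (there j∈p) → j∉p j∈p }))
          (+-identityˡ _)

  -- Associativity of the triple product x y z, obtained by exchanging two finite sums. It is the
  -- common source of `lincomb-assoc`, `apply-lincomb` and `apply-selfAdjoint`.
  sum-assoc : ∀ {m n} (x : Vector Carrier m) (y : Fin m → Fin n → Carrier) (z : Vector Carrier n) →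
              ∑[ i < m ] (x i * ∑[ j < n ] (y i j * z j)) ≈
              ∑[ j < n ] (∑[ i < m ] (x i * y i j) * z j)
  sum-assoc {m} {n} x y z = begin
    ∑[ i < m ] (x i * ∑[ j < n ] (y i j * z j))
      ≈⟨ sum-cong (λ i → *-distribˡ-sum (x i) λ j → y i j * z j) ⟩
    ∑[ i < m ] ∑[ j < n ] (x i * (y i j * z j))
      ≈⟨ sum-cong (λ i → sum-cong λ j → *-assoc (x i) (y i j) (z j)) ⟨
    ∑[ i < m ] ∑[ j < n ] (x i * y i j * z j)
      ≈⟨ ∑-comm (λ i j → x i * y i j * z j) ⟩
    ∑[ j < n ] ∑[ i < m ] (x i * y i j * z j)
      ≈⟨ sum-cong (λ j → *-distribʳ-sum (z j) (λ i → x i * y i j)) ⟨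
    ∑[ j < n ] (∑[ i < m ] (x i * y i j) * z j) ∎

  -- Matrices acting on vectors, and linear combinations.

  apply : ∀ {n} → SquareMatrix ℝ n → Vector Carrier n → Vector Carrier n
  apply {n} A x i = ∑[ j < n ] (A i j * x j)

  lincomb : ∀ {n k} → Vector Carrier k → Vector (Vector Carrier n) k → Vector Carrier n
  lincomb {k = k} a b i = ∑[ j < k ] (a j * b j i)

  lincomb-congˡ : ∀ {n k} {a a′ : Vector Carrier k} (b : Vector (Vector Carrier n) k) →
                  (∀ j → a j ≈ a′ j) → ∀ i → lincomb a b i ≈ lincomb a′ b i
  lincomb-congˡ b a≈a′ i = sum-cong λ j → *-congʳ (a≈a′ j)

  lincomb-zeroʳ : ∀ {n k} (a : Vector Carrier k) (b : Vector (Vector Carrier n) k) i →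
                  (∀ j → b j i ≈ 0#) → lincomb a b i ≈ 0#
  lincomb-zeroʳ a b i b≈0 = sum-zero λ j → trans (*-congˡ (b≈0 j)) (zeroʳ _)

  lincomb-assoc : ∀ {n k l} (a : Vector Carrier l) (u : Vector (Vector Carrier k) l)
                  (b : Vector (Vector Carrier n) k) i →
                  lincomb a (λ t → lincomb (u t) b) i ≈ lincomb (lincomb a u) b i
  lincomb-assoc a u b i = sum-assoc a u (λ j → b j i)

  lincomb-++ : ∀ {n k l} (a : Vector Carrier (k ℕ.+ l))
               (b : Vector (Vector Carrier n) k) (d : Vector (Vector Carrier n) l) i →
               lincomb a (b ++ d) i ≈ lincomb (a ∘ (_↑ˡ l)) b i + lincomb (a ∘ (k ↑ʳ_)) d i
  lincomb-++ {k = k} {l} a b d i = trans (sum-↑ k _) (+-cong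
    (sum-cong λ j → *-congˡ (reflexive (≡.cong (λ v → v i) (lookup-++ˡ b d j))))
    (sum-cong λ j → *-congˡ (reflexive (≡.cong (λ v → v i) (lookup-++ʳ b d j)))))

  apply-lincomb : ∀ {n k} (A : SquareMatrix ℝ n) (a : Vector Carrier k)
                  (b : Vector (Vector Carrier n) k) i →
                  apply A (lincomb a b) i ≈ lincomb a (λ j → apply A (b j)) i
  apply-lincomb {n} {k} A a b i = begin
    ∑[ j < n ] (A i j * ∑[ l < k ] (a l * b l j))
      ≈⟨ sum-cong (λ j → *-congˡ (sum-cong λ l → *-comm (a l) (b l j))) ⟩
    ∑[ j < n ] (A i j * ∑[ l < k ] (b l j * a l))
      ≈⟨ sum-assoc (A i) (λ j l → b l j) a ⟩
    ∑[ l < k ] (apply A (b l) i * a l)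
      ≈⟨ sum-cong (λ l → *-comm _ (a l)) ⟩
    ∑[ l < k ] (a l * apply A (b l) i) ∎

  apply-sub : ∀ {n} (A : SquareMatrix ℝ n) x y i →
            apply A (λ j → x j - y j) i ≈ apply A x i - apply A y i
  apply-sub {n} A x y i = begin
    ∑[ j < n ] (A i j * (x j - y j))
      ≈⟨ sum-cong (λ j → *-distribˡ-sub (A i j) (x j) (y j)) ⟩
    ∑[ j < n ] (A i j * x j + - 1# * (A i j * y j))
      ≈⟨ ∑-distrib-+ (λ j → A i j * x j) _ ⟩
    apply A x i + ∑[ j < n ] (- 1# * (A i j * y j))
      ≈⟨ +-congˡ (*-distribˡ-sum (- 1#) (λ j → A i j * y j)) ⟨
    apply A x i + - 1# * apply A y i
      ≈⟨ +-congˡ (-1* _) ⟨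
    apply A x i - apply A y i ∎
    where
    -1* : ∀ z → - z ≈ - 1# * z
    -1* z = trans (-‿cong (sym (*-identityˡ z))) (-‿distribˡ-* 1# z)
    *-distribˡ-sub : ∀ a b d → a * (b - d) ≈ a * b + - 1# * (a * d)
    *-distribˡ-sub a b d = trans (distribˡ a b (- d))
      (+-congˡ (trans (sym (-‿distribʳ-* a d)) (-1* (a * d))))

  apply-selfAdjoint : ∀ {n} {A : SquareMatrix ℝ n} → Symmetric ℝ A → ∀ x z →
                      ∑[ r < n ] (apply A x r * z r) ≈ ∑[ s < n ] (x s * apply A z s)
  apply-selfAdjoint {n} {A} A-sym x z = begin
    ∑[ r < n ] (apply A x r * z r)
      ≈⟨ sum-cong (λ r → *-congʳ (sum-cong λ s → trans (*-congʳ (A-sym r s)) (*-comm _ _))) ⟩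
    ∑[ r < n ] (∑[ s < n ] (x s * A s r) * z r)
      ≈⟨ sum-assoc x A z ⟨
    ∑[ s < n ] (x s * apply A z s) ∎

  -- Elimination and linear dependence.

  unit : ∀ {n} → Fin n → Vector Carrier n
  unit {n} i = updateAt (replicate n 0#) i (const 1#)

  unit-independent : ∀ {n} → LinearlyIndependent ℝ (unit {n})
  unit-independent {n} a ∑≈0 i = begin
    a i              ≈⟨ *-identityʳ _ ⟨
    a i * 1#         ≈⟨ *-congˡ (reflexive (updateAt-updates i (replicate n 0#))) ⟨
    a i * unit i i   ≈⟨ sum-single i (λ j j≢i → trans
                          (*-congˡ (reflexive (updateAt-minimal i j (replicate n 0#) (j≢i ∘ ≡.sym))))
                          (zeroʳ _)) ⟨
    lincomb a unit i ≈⟨ ∑≈0 i ⟩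
    0#               ∎

  -- A nonzero entry serves as pivot by division. If all entries are zero, any position works with
  -- zero multipliers, so the elimination below needs no separate case for a zero column.
  pivot : ∀ {n} (v : Vector Carrier (suc n)) →
          ∃₂ λ j (r : Vector Carrier n) → ∀ l → v (punchIn j l) ≈ r l * v j
  pivot v with any? (λ j → ¬? (v j ≟ 0#))
  ... | no all-zero = zero , const 0# , λ l →
          trans (decidable-stable (_ ≟ _) λ v≉0 → all-zero (suc l , v≉0)) (sym (zeroˡ _))
  ... | yes (j , vj≉0) = let y , vj*y≈1 = inverse (v j) vj≉0 in
          j , (λ l → v (punchIn j l) * y) , λ l → begin
            v (punchIn j l)             ≈⟨ *-identityʳ _ ⟨
            v (punchIn j l) * 1#        ≈⟨ *-congˡ (trans (*-comm _ _) vj*y≈1) ⟨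
            v (punchIn j l) * (y * v j) ≈⟨ *-assoc _ _ _ ⟨
            v (punchIn j l) * y * v j   ∎

  -- A relation among the vectors reduced by the pivot j extends to one among the
  -- original vectors, the coefficient at j being forced.
  sum-insertAt : ∀ {n} (v : Vector Carrier (suc n)) (j : Fin (suc n)) (r u : Vector Carrier n) →
                 sum (λ l → insertAt u j (- sum (λ i → u i * r i)) l * v l) ≈
                 sum (λ l → u l * (v (punchIn j l) - r l * v j))
  sum-insertAt {n} v j r u = begin
    sum (λ l → û l * v l)
      ≈⟨ sum-remove {i = j} (λ l → û l * v l) ⟩
    û j * v j + sum (λ l → û (punchIn j l) * v (punchIn j l))
      ≈⟨ +-cong (*-congʳ (reflexive (insertAt-lookup u j _)))
                (sum-cong λ l → *-congʳ (reflexive (insertAt-punchIn u j _ l))) ⟩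
    - sum (λ l → u l * r l) * v j + sum (λ l → u l * v (punchIn j l))
      ≈⟨ +-comm _ _ ⟩
    sum (λ l → u l * v (punchIn j l)) + - sum (λ l → u l * r l) * v j
      ≈⟨ +-congˡ (trans (sym (-‿distribˡ-* _ _)) (-‿distribʳ-* _ _)) ⟩
    sum (λ l → u l * v (punchIn j l)) + sum (λ l → u l * r l) * - v j
      ≈⟨ +-congˡ (*-distribʳ-sum (- v j) (λ l → u l * r l)) ⟩
    sum (λ l → u l * v (punchIn j l)) + sum (λ l → u l * r l * - v j)
      ≈⟨ ∑-distrib-+ (λ l → u l * v (punchIn j l)) _ ⟨
    sum (λ l → u l * v (punchIn j l) + u l * r l * - v j)
      ≈⟨ sum-cong (λ l → *-distribˡ-sub (u l) (v (punchIn j l)) (r l) (v j)) ⟨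
    sum (λ l → u l * (v (punchIn j l) - r l * v j)) ∎
    where
    û : Vector Carrier (suc n)
    û = insertAt u j (- sum (λ i → u i * r i))
    *-distribˡ-sub : ∀ a b d e → a * (b - d * e) ≈ a * b + a * d * - e
    *-distribˡ-sub a b d e = trans (distribˡ a b (- (d * e)))
      (+-congˡ (trans (*-congˡ (-‿distribʳ-* d e)) (sym (*-assoc a d (- e)))))

  -- Gaussian elimination by induction on the number of coordinates: subtracting multiples of the
  -- pivot vector clears coordinate zero, and the pivot vector is then dropped, which lowers both
  -- `p` and `N` by one. The length is a separate `N`, so that callers may keep their own form of
  -- it.
  relations : ∀ p {q N} → N ≡ p ℕ.+ q → (M : Vector (Vector Carrier p) N) →
              Σ (Vector (Vector Carrier N) q) λ u →
                LinearlyIndependent ℝ u × (∀ t i → lincomb (u t) M i ≈ 0#)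
  -- With no coordinates every coefficient vector is a relation, so the unit vectors supply all `q`
  -- of them.
  relations zero ≡.refl M = unit , unit-independent , λ t ()
  relations (suc p) {q} ≡.refl M = û , û-independent , û-relation
    where
    j = proj₁ (pivot (λ l → M l zero))
    r = proj₁ (proj₂ (pivot (λ l → M l zero)))
    r-spec = proj₂ (proj₂ (pivot (λ l → M l zero)))

    M′ : Vector (Vector Carrier p) (p ℕ.+ q)
    M′ l i = M (punchIn j l) (suc i) - r l * M j (suc i)

    IH = relations p ≡.refl M′
    u = proj₁ IH

    û : Vector (Vector Carrier (suc (p ℕ.+ q))) q
    û t = insertAt (u t) j (- sum (λ l → u t l * r l))

    -- Away from position `j` the extended relations coincide with `u`, and these entries alone
    -- already force independence.
    û-independent : LinearlyIndependent ℝ û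
    û-independent a ∑≈0 = proj₁ (proj₂ IH) a λ l → trans
      (sum-cong λ t → *-congˡ (reflexive (≡.sym (insertAt-punchIn (u t) j _ l))))
      (∑≈0 (punchIn j l))

    û-relation : ∀ t i → lincomb (û t) M i ≈ 0#
    û-relation t zero = trans (sum-insertAt (λ l → M l zero) j r (u t))
      (sum-zero λ l → trans (*-congˡ (trans (+-congʳ (r-spec l)) (-‿inverseʳ _))) (zeroʳ _))
    û-relation t (suc i) = trans (sum-insertAt (λ l → M l (suc i)) j r (u t))
      (proj₂ (proj₂ IH) t i)

  -- The `suc k` coefficient vectors have only `k` coordinates, so they satisfy a relation that is
  -- independent as a family of one vector. The same relation holds among the `w t`.
  dependent : ∀ {n k} {b : Vector (Vector Carrier n) k} {w : Vector (Vector Carrier n) (suc k)} →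
              (∀ t → InSpan ℝ b (w t)) → ¬ LinearlyIndependent ℝ w
  dependent {k = k} {b} {w} w∈ w-independent =
    -- If `w` were independent, the relation would be the zero vector; its multiple by 1 would then
    -- vanish, and the independence of `u` would give 1 = 0.
    0≉1 (sym (u-independent (const 1#) (λ l → trans (+-identityʳ _)
      (trans (*-identityˡ _) (w-independent (u zero) uw≈0 l))) zero))
    where
    C : Vector (Vector Carrier k) (suc k)
    C t = proj₁ (w∈ t)
    rel = relations k {1} (ℕ.+-comm 1 k) C
    u = proj₁ rel
    u-independent = proj₁ (proj₂ rel)

    uw≈0 : ∀ i → lincomb (u zero) w i ≈ 0#
    uw≈0 i = begin
      lincomb (u zero) w i                       ≈⟨ sum-cong (λ t → *-congˡ {u zero t} (proj₂ (w∈ t) i)) ⟨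
      lincomb (u zero) (λ t → lincomb (C t) b) i ≈⟨ lincomb-assoc (u zero) C b i ⟩
      lincomb (lincomb (u zero) C) b i           ≈⟨ sum-zero (λ j →
                                                      trans (*-congʳ (proj₂ (proj₂ rel) zero j)) (zeroˡ _)) ⟩
      0#                                         ∎

  -- Without coordinate `i` there remain one coordinate fewer and hence `suc k` independent
  -- relations. Either one of them has a nonzero value at `i`, and dividing by that value yields the
  -- unit vector, or all of them are relations in coordinate `i` too. This takes the place of a
  -- rank-nullity count.
  unit-or-relations : ∀ {k m} (M : Vector (Vector Carrier m) (k ℕ.+ m)) (i : Fin m) →
    (∃ λ a → lincomb a M i ≈ 1# × (∀ j → j ≢ i → lincomb a M j ≈ 0#)) ⊎
    (Σ (Vector (Vector Carrier (k ℕ.+ m)) (suc k)) λ u →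
      LinearlyIndependent ℝ u × (∀ t j → lincomb (u t) M j ≈ 0#))
  unit-or-relations {k} {suc m} M i
    with u , u-independent , u-relation ← relations m {suc k}
           (≡.trans (ℕ.+-suc k m) (≡.trans (≡.cong suc (ℕ.+-comm k m)) (≡.sym (ℕ.+-suc m k))))
           (λ l → M l ∘ punchIn i)
    with any? (λ t → ¬? (lincomb (u t) M i ≟ 0#))
  ... | yes (t , s≉0) = inj₁ (a , a-unit , a-relation)
    where
    s = lincomb (u t) M i
    y = proj₁ (inverse s s≉0)

    a : Vector Carrier (k ℕ.+ suc m)
    a l = y * u t l

    scale : ∀ j → lincomb a M j ≈ y * lincomb (u t) M j
    scale j = trans (sum-cong λ l → *-assoc y (u t l) (M l j)) (sym (*-distribˡ-sum y λ l → u t l * M l j))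

    a-unit : lincomb a M i ≈ 1#
    a-unit = trans (scale i) (trans (*-comm _ _) (proj₂ (inverse s s≉0)))

    a-relation : ∀ j → j ≢ i → lincomb a M j ≈ 0#
    a-relation j j≢i = trans (scale j) (trans (*-congˡ relation-j) (zeroʳ _))
      where
      relation-j : lincomb (u t) M j ≈ 0#
      relation-j = ≡.subst (λ j → lincomb (u t) M j ≈ 0#)
        (punchIn-punchOut (j≢i ∘ ≡.sym)) (u-relation t _)
  ... | no all-zero = inj₂ (u , u-independent , u-vanish)
    where
    u-vanish : ∀ t j → lincomb (u t) M j ≈ 0#
    u-vanish t j with j Fin.≟ i
    ... | yes ≡.refl = decidable-stable (_ ≟ _) λ s≉0 → all-zero (t , s≉0)
    ... | no  j≢i    = ≡.subst (λ j → lincomb (u t) M j ≈ 0#)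
      (punchIn-punchOut (j≢i ∘ ≡.sym)) (u-relation t _)

  -- Extension by zero.

  extend : ∀ {n} (p : Subset n) → Vector Carrier ∣ p ∣ → Vector Carrier n
  extend (inside  Vec.∷ p) y zero    = y zero
  extend (inside  Vec.∷ p) y (suc j) = extend p (y ∘ suc) j
  extend (outside Vec.∷ p) y zero    = 0#
  extend (outside Vec.∷ p) y (suc j) = extend p y j

  extend-enumerate : ∀ {n} (p : Subset n) y i → extend p y (enumerate p i) ≈ y i
  extend-enumerate (inside  Vec.∷ p) y zero    = refl
  extend-enumerate (inside  Vec.∷ p) y (suc i) = extend-enumerate p (y ∘ suc) i
  extend-enumerate (outside Vec.∷ p) y i       = extend-enumerate p y i

  extend-∉ : ∀ {n} (p : Subset n) y {j} → j ∉ p → extend p y j ≈ 0#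
  extend-∉ (inside  Vec.∷ p) y {zero}  j∉p = contradiction here j∉p
  extend-∉ (inside  Vec.∷ p) y {suc j} j∉p = extend-∉ p (y ∘ suc) (j∉p ∘ there)
  extend-∉ (outside Vec.∷ p) y {zero}  j∉p = refl
  extend-∉ (outside Vec.∷ p) y {suc j} j∉p = extend-∉ p y (j∉p ∘ there)

  -- Preimages of unit vectors, obtained from the nullities.

  Vanishes : ∀ {n} → Subset n → Vector Carrier n → Set _
  Vanishes α x = ∀ j → j ∈ α → x j ≈ 0#

  module _ {n} (A : SquareMatrix ℝ n) where

    -- A solution x of A x = e_i that vanishes on `α`. The equation is split into entry `i` and the
    -- remaining entries, the form in which `sum-single` consumes it.
    record UnitPreimage (α : Subset n) (i : Fin n) : Set (c ⊔ ℓ₁) where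
      field
        vector      : Vector Carrier n
        vanishes    : Vanishes α vector
        diagonal    : apply A vector i ≈ 1#
        offDiagonal : ∀ r → r ≢ i → apply A vector r ≈ 0#

    open UnitPreimage

    UnitPreimages : Subset n → Set _
    UnitPreimages α = ∀ i → i ∈ α → UnitPreimage α i

    restrictPreimage : ∀ {α γ i} → γ ⊆ α → UnitPreimage α i → UnitPreimage γ i
    restrictPreimage γ⊆α X = record
      { vector      = vector X
      ; vanishes    = λ j j∈γ → vanishes X j (γ⊆α j∈γ)
      ; diagonal    = diagonal X
      ; offDiagonal = offDiagonal X
      }

    apply-delete : ∀ (α : Subset n) {x} → Vanishes α x → ∀ i →
                   apply (delete ℝ A α) (x ∘ enumerate (∁ α)) i ≈ apply A x (enumerate (∁ α) i)
    apply-delete α x≈0 i = sym (sum-enumerate (∁ α) λ j j∉∁α →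
      trans (*-congˡ (x≈0 j (x∉∁p⇒x∈p j∉∁α))) (zeroʳ _))

    lincomb-vanishes : ∀ {α : Subset n} {k} (a : Vector Carrier k) {b : Vector (Vector Carrier n) k} →
                       (∀ j → Vanishes α (b j)) → Vanishes α (lincomb a b)
    lincomb-vanishes a {b} b≈0 i i∈α = lincomb-zeroʳ a b i λ j → b≈0 j i i∈α

    extend-vanishes : ∀ (α : Subset n) y → Vanishes α (extend (∁ α) y)
    extend-vanishes α y j j∈α = extend-∉ (∁ α) y (x∈p⇒x∉∁p j∈α)

    -- Extension by zero identifies ker A(α) with the vectors that vanish on `α` and whose image
    -- under A is supported on `α`.
    apply-extend-∉ : ∀ (α : Subset n) {y} → Kernel ℝ (delete ℝ A α) y →
                     ∀ {r} → r ∉ α → apply A (extend (∁ α) y) r ≈ 0#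
    apply-extend-∉ α {y} y∈ker {r} r∉α
      with r′ , ≡.refl ← enumerate-surjective (∁ α) (x∉p⇒x∈∁p r∉α) = begin
      apply A (extend (∁ α) y) (enumerate (∁ α) r′)
        ≈⟨ apply-delete α (extend-vanishes α y) r′ ⟨
      apply (delete ℝ A α) (extend (∁ α) y ∘ enumerate (∁ α)) r′
        ≈⟨ sum-cong (λ j → *-congˡ (extend-enumerate (∁ α) y j)) ⟩
      apply (delete ℝ A α) y r′
        ≈⟨ y∈ker r′ ⟩
      0# ∎

    -- A maps the `k + ∣ α ∣` extended basis vectors of ker A(α) to vectors supported on `α`. If e_i
    -- were not a combination of these images, there would be `suc k` independent relations among
    -- them, hence `suc k` independent vectors in ker A, which is spanned by `k` vectors.
    nullity⇒preimages : ∀ {k} (α : Subset n) → HasNullity ℝ A k →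
                        HasNullity ℝ (delete ℝ A α) (k ℕ.+ ∣ α ∣) → UnitPreimages α
    nullity⇒preimages {k} α (b , b-basis) (v , v-basis) i i∈α
      with i′ , ≡.refl ← enumerate-surjective α i∈α =
      [ (λ (a , a-unit , a-relation) → record
          { vector      = lincomb a V
          ; vanishes    = lincomb-vanishes a V-vanishes
          ; diagonal    = trans (apply-lincomb A a V _) a-unit
          ; offDiagonal = off-diagonal a a-relation
          })
      , (λ (u , u-independent , u-relation) → contradiction
          -- The combinations of `V` given by `u` are independent: a relation among them restricts
          -- to one among the basis `v`, so `lincomb a u` vanishes, and then `a` does.
          (λ a ∑≈0 → u-independent a (independent v-basis (lincomb a u) (restrict a u ∑≈0)))
          (dependent λ t → spanning b-basis (lincomb (u t) V) (in-kernel (u t) (u-relation t))))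
      ]′ (unit-or-relations {k} M i′)
      where
      open IsBasis
      V : Vector (Vector Carrier n) (k ℕ.+ ∣ α ∣)
      V l = extend (∁ α) (v l)

      -- Only the rows in `α` are recorded, since the images vanish in all other rows.
      M : Vector (Vector Carrier ∣ α ∣) (k ℕ.+ ∣ α ∣)
      M l = apply A (V l) ∘ enumerate α

      V-vanishes : ∀ l → Vanishes α (V l)
      V-vanishes l = extend-vanishes α (v l)

      apply-lincomb-∉ : ∀ a {r} → r ∉ α → apply A (lincomb a V) r ≈ 0#
      apply-lincomb-∉ a {r} r∉α = trans (apply-lincomb A a V r)
        (lincomb-zeroʳ a (λ l → apply A (V l)) r λ l → apply-extend-∉ α (contained v-basis l) r∉α)

      off-diagonal : ∀ a {i′} → (∀ j → j ≢ i′ → lincomb a M j ≈ 0#) →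
                     ∀ r → r ≢ enumerate α i′ → apply A (lincomb a V) r ≈ 0#
      off-diagonal a a-relation r r≢i with r ∈? α
      ... | no  r∉α = apply-lincomb-∉ a r∉α
      ... | yes r∈α with r′ , ≡.refl ← enumerate-surjective α r∈α =
        trans (apply-lincomb A a V _) (a-relation r′ (r≢i ∘ ≡.cong (enumerate α)))

      in-kernel : ∀ a → (∀ j → lincomb a M j ≈ 0#) → Kernel ℝ A (lincomb a V)
      in-kernel a a-relation r with r ∈? α
      ... | no  r∉α = apply-lincomb-∉ a r∉α
      ... | yes r∈α with r′ , ≡.refl ← enumerate-surjective α r∈α =
        trans (apply-lincomb A a V _) (a-relation r′)

      restrict : ∀ {q} (a : Vector Carrier q) u →
                 (∀ j → lincomb a (λ t → lincomb (u t) V) j ≈ 0#) →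
                 ∀ j → lincomb (lincomb a u) v j ≈ 0#
      restrict a u ∑≈0 j = begin
        lincomb (lincomb a u) v j
          ≈⟨ sum-cong (λ l → *-congˡ (extend-enumerate (∁ α) (v l) j)) ⟨
        lincomb (lincomb a u) V (enumerate (∁ α) j)
          ≈⟨ lincomb-assoc a u V _ ⟨
        lincomb a (λ t → lincomb (u t) V) (enumerate (∁ α) j)
          ≈⟨ ∑≈0 _ ⟩
        0# ∎

    -- Nullity of the principal submatrix, obtained from preimages for symmetric A.

    module _ (A-sym : Symmetric ℝ A) where

      -- With A x = e_i, z_i = ⟨A x, z⟩ = ⟨x, A z⟩ = 0.
      kernel-vanishes : ∀ {α i} → UnitPreimage α i → ∀ {z} → Kernel ℝ A z → z i ≈ 0#
      kernel-vanishes {i = i} X {z} z∈ker = begin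
        z i
          ≈⟨ *-identityˡ _ ⟨
        1# * z i
          ≈⟨ *-congʳ (diagonal X) ⟨
        apply A (vector X) i * z i
          ≈⟨ sum-single i (λ r r≢i → trans (*-congʳ (offDiagonal X r r≢i)) (zeroˡ _)) ⟨
        sum (λ r → apply A (vector X) r * z r)
          ≈⟨ apply-selfAdjoint A-sym (vector X) z ⟩
        sum (λ s → vector X s * apply A z s)
          ≈⟨ sum-zero (λ s → trans (*-congˡ (z∈ker s)) (zeroʳ _)) ⟩
        0# ∎

      -- The basis of ker A(α) is `b` followed by the preimages `x`, both restricted to the
      -- complement of `α`. Symmetry enters through `kernel-vanishes`, which makes `b` vanish on
      -- `α`, so that nothing is lost by the restriction.
      preimages⇒nullity : ∀ {k} (α : Subset n) → HasNullity ℝ A k → UnitPreimages α →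
                          HasNullity ℝ (delete ℝ A α) (k ℕ.+ ∣ α ∣)
      preimages⇒nullity {k} α (b , b-basis) Q = (λ j → B j ∘ enumerate (∁ α)) , record
        { contained   = contained′
        ; independent = independent′
        ; spanning    = spanning′
        }
        where
        open IsBasis b-basis
        X : ∀ i → UnitPreimage α (enumerate α i)
        X i = Q (enumerate α i) (enumerate-∈ α i)

        x : Vector (Vector Carrier n) ∣ α ∣
        x i = vector (X i)

        B : Vector (Vector Carrier n) (k ℕ.+ ∣ α ∣)
        B = b ++ x

        B-elim : ∀ {p} (P : Vector Carrier n → Set p) →
                 (∀ j → P (b j)) → (∀ i → P (x i)) → ∀ l → P (B l)
        B-elim P Pb Px l with splitAt k l
        ... | inj₁ j = Pb j
        ... | inj₂ i = Px i

        kernel-vanishes-α : ∀ {z} → Kernel ℝ A z → Vanishes α z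
        kernel-vanishes-α z∈ker i i∈α = kernel-vanishes (Q i i∈α) z∈ker

        B-vanishes : ∀ l → Vanishes α (B l)
        B-vanishes = B-elim (Vanishes α) (λ j → kernel-vanishes-α (contained j)) (λ i → vanishes (X i))

        apply-B-∉ : ∀ l r → r ∉ α → apply A (B l) r ≈ 0#
        apply-B-∉ = B-elim (λ y → ∀ r → r ∉ α → apply A y r ≈ 0#)
          (λ j r _ → contained j r)
          (λ i r r∉α → offDiagonal (X i) r λ r≡i → r∉α (≡.subst (_∈ α) (≡.sym r≡i) (enumerate-∈ α i)))

        contained′ : ∀ l → Kernel ℝ (delete ℝ A α) (B l ∘ enumerate (∁ α))
        contained′ l i = trans (apply-delete α (B-vanishes l) i)
          (apply-B-∉ l _ (x∈∁p⇒x∉p (enumerate-∈ (∁ α) i)))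

        -- The images A x_j are distinct unit vectors, so applying A to a combination of `x` reads
        -- off its coefficients.
        apply-x : ∀ (d : Vector Carrier ∣ α ∣) i → apply A (lincomb d x) (enumerate α i) ≈ d i
        apply-x d i = begin
          apply A (lincomb d x) (enumerate α i)
            ≈⟨ apply-lincomb A d x _ ⟩
          lincomb d (λ j → apply A (x j)) (enumerate α i)
            ≈⟨ sum-single i (λ j j≢i → trans (*-congˡ (offDiagonal (X j) _
                 (j≢i ∘ ≡.sym ∘ enumerate-injective α))) (zeroʳ _)) ⟩
          d i * apply A (x i) (enumerate α i)
            ≈⟨ *-congˡ (diagonal (X i)) ⟩
          d i * 1#
            ≈⟨ *-identityʳ _ ⟩
          d i ∎

        lincomb-b∈ker : ∀ e → Kernel ℝ A (lincomb e b)
        lincomb-b∈ker e r = trans (apply-lincomb A e b r)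
          (lincomb-zeroʳ e (λ j → apply A (b j)) r λ j → contained j r)

        module _ (a : Vector Carrier (k ℕ.+ ∣ α ∣))
                 (∑≈0 : ∀ i → lincomb a (λ l → B l ∘ enumerate (∁ α)) i ≈ 0#) where
          aˡ = a ∘ (_↑ˡ ∣ α ∣)
          aʳ = a ∘ (k ↑ʳ_)

          -- The relation is given only off `α`; it extends to all coordinates because every `B l`
          -- vanishes on `α`.
          ∑B≈0 : ∀ r → lincomb a B r ≈ 0#
          ∑B≈0 r with r ∈? α
          ... | yes r∈α = lincomb-vanishes a B-vanishes r r∈α
          ... | no  r∉α with r′ , ≡.refl ← enumerate-surjective (∁ α) (x∉p⇒x∈∁p r∉α) = ∑≈0 r′

          lincomb-x∈ker : Kernel ℝ A (lincomb aʳ x)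
          lincomb-x∈ker r = begin
            apply A (lincomb aʳ x) r
              -- The `x` part is the whole combination minus its `b` part: the whole is zero and the
              -- `b` part lies in ker A.
              ≈⟨ sum-cong (λ j → *-congˡ (xyx⁻¹≈y (lincomb aˡ b j) _)) ⟨
            apply A (λ j → lincomb aˡ b j + lincomb aʳ x j - lincomb aˡ b j) r
              ≈⟨ apply-sub A _ (lincomb aˡ b) r ⟩
            apply A (λ j → lincomb aˡ b j + lincomb aʳ x j) r - apply A (lincomb aˡ b) r
              ≈⟨ +-cong (sum-zero λ j → trans (*-congˡ (trans (sym (lincomb-++ a b x j)) (∑B≈0 j))) (zeroʳ _))
                        (trans (-‿cong (lincomb-b∈ker aˡ r)) -0#≈0#) ⟩
            0# + 0#
              ≈⟨ +-identityˡ _ ⟩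
            0# ∎

          aʳ≈0 : ∀ i → aʳ i ≈ 0#
          aʳ≈0 i = trans (sym (apply-x aʳ i)) (lincomb-x∈ker (enumerate α i))

          aˡ≈0 : ∀ j → aˡ j ≈ 0#
          aˡ≈0 = independent aˡ λ r → begin
            lincomb aˡ b r
              ≈⟨ +-identityʳ _ ⟨
            lincomb aˡ b r + 0#
              ≈⟨ +-congˡ (sum-zero λ i → trans (*-congʳ (aʳ≈0 i)) (zeroˡ _)) ⟨
            lincomb aˡ b r + lincomb aʳ x r
              ≈⟨ lincomb-++ a b x r ⟨
            lincomb a B r
              ≈⟨ ∑B≈0 r ⟩
            0# ∎

          independent′ : ∀ l → a l ≈ 0#
          independent′ l with splitAt k l in eq
          ... | inj₁ j = trans (reflexive (≡.cong a (≡.sym (splitAt⁻¹-↑ˡ eq)))) (aˡ≈0 j)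
          ... | inj₂ i = trans (reflexive (≡.cong a (≡.sym (splitAt⁻¹-↑ʳ {m = k} eq)))) (aʳ≈0 i)

        spanning′ : ∀ y → Kernel ℝ (delete ℝ A α) y → InSpan ℝ (λ l → B l ∘ enumerate (∁ α)) y
        -- Here `d` holds the entries of A Y on `α`, where Y is `y` extended by zero. Subtracting
        -- `lincomb d x` from Y leaves a vector Z of ker A, and `e` holds the coefficients of Z in
        -- `b`.
        spanning′ y y∈ker = e ++ d , λ i → begin
          lincomb (e ++ d) B (enumerate (∁ α) i)
            ≈⟨ lincomb-++ (e ++ d) b x _ ⟩
          lincomb ((e ++ d) ∘ (_↑ˡ ∣ α ∣)) b (enumerate (∁ α) i) +
          lincomb ((e ++ d) ∘ (k ↑ʳ_)) x (enumerate (∁ α) i)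
            ≈⟨ +-cong (lincomb-congˡ b (λ j → reflexive (lookup-++ˡ e d j)) _)
                      (lincomb-congˡ x (λ j → reflexive (lookup-++ʳ e d j)) _) ⟩
          lincomb e b (enumerate (∁ α) i) + lincomb d x (enumerate (∁ α) i)
            ≈⟨ +-congʳ (proj₂ (spanning Z Z∈ker) _) ⟩
          Z (enumerate (∁ α) i) + lincomb d x (enumerate (∁ α) i)
            ≈⟨ //-rightDividesˡ _ _ ⟩
          Y (enumerate (∁ α) i)
            ≈⟨ extend-enumerate (∁ α) y i ⟩
          y i ∎
          where
          Y Z : Vector Carrier n
          d : Vector Carrier ∣ α ∣
          Y = extend (∁ α) y
          d = apply A Y ∘ enumerate α
          Z j = Y j - lincomb d x j

          apply-Y≈apply-x : ∀ r → apply A Y r ≈ apply A (lincomb d x) r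
          apply-Y≈apply-x r with r ∈? α
          ... | yes r∈α with r′ , ≡.refl ← enumerate-surjective α r∈α = sym (apply-x d r′)
          ... | no  r∉α = trans (apply-extend-∉ α y∈ker r∉α)
            (sym (trans (apply-lincomb A d x r) (lincomb-zeroʳ d (λ i → apply A (x i)) r λ i → offDiagonal (X i) r
              λ r≡i → r∉α (≡.subst (_∈ α) (≡.sym r≡i) (enumerate-∈ α i)))))

          Z∈ker : Kernel ℝ A Z
          Z∈ker r = trans (apply-sub A Y (lincomb d x) r)
            (trans (+-congʳ (apply-Y≈apply-x r)) (-‿inverseʳ _))

          e : Vector Carrier k
          e = proj₁ (spanning Z Z∈ker)

      -- Reduction to pairs.

      -- The difference of two preimages of e_i lies in ker A, and `Y`, a preimage of e_j, makes
      -- every kernel vector vanish at `j`. The three subsets may differ, so preimages coming from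
      -- different pairs can be compared.
      preimages-agree : ∀ {α γ δ i j} (X : UnitPreimage α i) (X′ : UnitPreimage γ i) →
                        UnitPreimage δ j → vector X j ≈ vector X′ j
      preimages-agree {i = i} X X′ Y = x∙y⁻¹≈ε⇒x≈y _ _ (kernel-vanishes Y λ r →
        trans (apply-sub A (vector X) (vector X′) r) (trans (+-congʳ (same r)) (-‿inverseʳ _)))
        where
        same : ∀ r → apply A (vector X) r ≈ apply A (vector X′) r
        same r with r Fin.≟ i
        ... | yes ≡.refl = trans (diagonal X) (sym (diagonal X′))
        ... | no  r≢i    = trans (offDiagonal X r r≢i) (sym (offDiagonal X′ r r≢i))

      preimages-pairwise : ∀ α → 2 ≤ ∣ α ∣ →
        (∀ {i j} → i ∈ α → j ∈ α → i ≢ j → UnitPreimages (⁅ i ⁆ ∪ ⁅ j ⁆)) → UnitPreimages α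
      preimages-pairwise α 2≤∣α∣ Q i i∈α with j , j∈α , i≢j ← another-∈ α 2≤∣α∣ i∈α = record
        { vector      = vector X
        ; vanishes    = X-vanishes
        ; diagonal    = diagonal X
        ; offDiagonal = offDiagonal X
        }
        where
        ∈ˡ : ∀ {l} → i ∈ ⁅ i ⁆ ∪ ⁅ l ⁆
        ∈ˡ = x∈p∪q⁺ (inj₁ (x∈⁅x⁆ i))
        ∈ʳ : ∀ {l} → l ∈ ⁅ i ⁆ ∪ ⁅ l ⁆
        ∈ʳ {l} = x∈p∪q⁺ (inj₂ (x∈⁅x⁆ l))
        X = Q i∈α j∈α i≢j i ∈ˡ

        X-vanishes : Vanishes α (vector X)
        X-vanishes l l∈α with i Fin.≟ l
        ... | yes ≡.refl = vanishes X i ∈ˡ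
        -- The pair {i, l} has its own preimage of e_i, which vanishes at `l`, and a preimage of
        -- e_l, which forces `X` to agree with it there.
        ... | no  i≢l    = trans (preimages-agree X (P i ∈ˡ) (P l ∈ʳ)) (vanishes (P i ∈ˡ) l ∈ʳ)
          where P = Q i∈α l∈α i≢l

      psets⇔pairs : ∀ α → 2 ≤ ∣ α ∣ →
        IsPSet ℝ A α ⇔ (∀ γ → γ ⊆ α → ∣ γ ∣ ≡ 2 → IsPSet ℝ A γ)
      psets⇔pairs α 2≤∣α∣ = mk⇔ to from
        where
        preimages : ∀ γ → IsPSet ℝ A γ → UnitPreimages γ
        preimages γ (_ , ν , νγ) = nullity⇒preimages γ ν νγ

        to : IsPSet ℝ A α → ∀ γ → γ ⊆ α → ∣ γ ∣ ≡ 2 → IsPSet ℝ A γ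
        to (k , ν , να) γ γ⊆α _ = k , ν , preimages⇒nullity γ ν λ i i∈γ →
          restrictPreimage γ⊆α (nullity⇒preimages α ν να i (γ⊆α i∈γ))

        from : (∀ γ → γ ⊆ α → ∣ γ ∣ ≡ 2 → IsPSet ℝ A γ) → IsPSet ℝ A α
        from pairs =
          -- Since `α` has at least two elements it contains a pair, and the P-set property of that
          -- pair supplies a nullity `k` of A. The other pairs contribute only preimages, so their
          -- nullities need not be compared with `k`.
          let i∈α          = enumerate-∈ α (fromℕ< 2≤∣α∣)
              _ , j∈α , i≢j = another-∈ α 2≤∣α∣ i∈α
              k , ν , _    = pair i∈α j∈α i≢j
          in k , ν , preimages⇒nullity α ν (preimages-pairwise α 2≤∣α∣ λ i∈α j∈α i≢j →
               preimages _ (pair i∈α j∈α i≢j))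
          where
          pair : ∀ {i j} → i ∈ α → j ∈ α → i ≢ j → IsPSet ℝ A (⁅ i ⁆ ∪ ⁅ j ⁆)
          pair i∈α j∈α i≢j = pairs _ (pair⊆ i∈α j∈α) (∣⁅x⁆∪⁅y⁆∣≡2 i≢j)

theorem2p5 : ∀ {c ℓ₁ ℓ₂} (ℝ : Reals c ℓ₁ ℓ₂) (n : ℕ) (A : SquareMatrix ℝ n) → Symmetric ℝ A →
    (α : Subset n) → 2 ≤ ∣ α ∣ →
    IsPSet ℝ A α ⇔ (∀ (γ : Subset n) → γ ⊆ α → ∣ γ ∣ ≡ 2 → IsPSet ℝ A γ)
theorem2p5 ℝ n A A-sym α 2≤∣α∣ = psets⇔pairs ℝ A A-sym α 2≤∣α∣
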